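{- Let $h,s\in\mathbb{R}$ with $s\neq 0$, let $\zeta(h,s)$ be the set of zeros of the Ramanujan cubic polynomial $\rho(h,s,x)$, and let $\alpha\in\zeta(h,s)$. Then $$\zeta(h,s)=\left\{\alpha,\ \frac{s^2}{s-\alpha},\ -\frac{s(s-\alpha)}{\alpha}\right\}=\{\alpha,\eta_s(\alpha),\eta_s^2(\alpha)\},\qquad\text{where } \eta_s(z)=\frac{s^2}{s-z}.$$ Moreover, for any Ramanujan cubic polynomial $x^3+px^2+qx+r=\rho\left(\frac{p}{r^{1/3}},r^{1/3},x\right)$ we have $$\zeta\left(\frac{p}{r^{1/3}},r^{1/3}\right)=-r^{1/3}\,\zeta\left(\frac{p}{r^{1/3}},-1\right).$$
   Context: A Ramanujan cubic polynomial (RCP) is a cubic polynomial $x^3+px^2+qx+r$ with $p,q,r\in\mathbb{R}$, $r\neq 0$, all of whose zeros are real and whose coefficients satisfy $p\,r^{1/3}+3\,r^{2/3}+q=0$ (real cube roots). For $h,s\in\mathbb{R}$, $s\ne0$, set $\rho(h,s,x)=x^3+hsx^2-(h+3)s^2x+s^3$; the RCPs are exactly the polynomials $\rho(h,s,x)$, with $h=p/r^{1/3}$ and $s=r^{1/3}$. $\zeta(h,s)$ denotes the set of zeros of $\rho(h,s,x)$; $\eta_s^2$ denotes the composition $\eta_s\circ\eta_s$; for a number $c$ and a set $Z$ of numbers, $cZ=\{cz: z\in Z\}$. -}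

module Defs where

open import Algebra.Bundles.Raw using (RawRing)
open import Data.Integer.Base using (+_)
open import Data.Nat.Base as ℕ using (ℕ)
import Data.Nat.Properties as ℕₚ
open import Data.Product using (∃-syntax; Σ-syntax; _×_; _,_)
open import Data.Rational using (ℚ; 0ℚ; 1ℚ; ½; positive; nonNegative; nonPositive; ≢-nonZero)
import Data.Rational as ℚ
import Data.Rational.Properties as ℚₚ
open import Data.Rational.Solver using (module +-*-Solver)
open import Data.Sum using (_⊎_; inj₁; inj₂)
open import Level using (0ℓ)
open import Relation.Binary.PropositionalEquality using (_≡_; _≢_; refl; sym; trans; cong; cong₂; subst; subst₂)
open import Relation.Nullary using (yes; no; contradiction)
open import Relation.Unary using (Pred)

private
  infix 4 _<_ _≤_
  _<_ _≤_ : ℚ → ℚ → Set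
  _<_ = ℚ._<_
  _≤_ = ℚ._≤_

module Estimates where

  ∣_∣ : ℚ → ℚ
  ∣_∣ = ℚ.∣_∣

  *-pos : ∀ {p q} → 0ℚ < p → 0ℚ < q → 0ℚ < p ℚ.* q
  *-pos {p} {q} 0<p 0<q =
    ℚₚ.positive⁻¹ (p ℚ.* q) {{ℚₚ.pos*pos⇒pos p {{positive 0<p}} q {{positive 0<q}}}}

  half-pos : ∀ {ε} → 0ℚ < ε → 0ℚ < ½ ℚ.* ε
  half-pos = *-pos (ℚₚ.positive⁻¹ ½)

  halves : ∀ ε → ½ ℚ.* ε ℚ.+ ½ ℚ.* ε ≡ ε
  halves ε = trans (sym (ℚₚ.*-distribʳ-+ ε ½ ½)) (ℚₚ.*-identityˡ ε)

  *-mono-≤ : ∀ {a b c d} → 0ℚ ≤ c → 0ℚ ≤ b → a ≤ b → c ≤ d → a ℚ.* c ≤ b ℚ.* d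
  *-mono-≤ {a} {b} {c} {d} 0≤c 0≤b a≤b c≤d = ℚₚ.≤-trans
    (ℚₚ.*-monoʳ-≤-nonNeg c {{nonNegative 0≤c}} a≤b)
    (ℚₚ.*-monoˡ-≤-nonNeg b {{nonNegative 0≤b}} c≤d)

  pos⇒≢0 : ∀ {q} → 0ℚ < ∣ q ∣ → q ≢ 0ℚ
  pos⇒≢0 0<∣q∣ refl = ℚₚ.<-irrefl refl 0<∣q∣

  private
    +-diff : ∀ a b c d → (a ℚ.- c) ℚ.+ (b ℚ.- d) ≡ (a ℚ.+ b) ℚ.- (c ℚ.+ d)
    +-diff = solve 4 (λ a b c d → (a :- c) :+ (b :- d) := (a :+ b) :- (c :+ d)) refl
      where open +-*-Solver

    *-diff : ∀ a b c d → a ℚ.* (b ℚ.- d) ℚ.+ (a ℚ.- c) ℚ.* d ≡ a ℚ.* b ℚ.- c ℚ.* d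
    *-diff = solve 4 (λ a b c d → a :* (b :- d) :+ (a :- c) :* d := a :* b :- c :* d) refl
      where open +-*-Solver

    neg-diff : ∀ a b → ℚ.- (a ℚ.- b) ≡ (ℚ.- a) ℚ.- (ℚ.- b)
    neg-diff = solve 2 (λ a b → :- (a :- b) := (:- a) :- (:- b)) refl
      where open +-*-Solver

    recover : ∀ a b → a ≡ (a ℚ.- b) ℚ.+ b
    recover = solve 2 (λ a b → a := (a :- b) :+ b) refl
      where open +-*-Solver

  +-close : ∀ {ε} a b c d → ∣ a ℚ.- c ∣ < ½ ℚ.* ε → ∣ b ℚ.- d ∣ < ½ ℚ.* ε →
            ∣ (a ℚ.+ b) ℚ.- (c ℚ.+ d) ∣ < ε
  +-close {ε} a b c d ac bd = ℚₚ.≤-<-trans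
    (subst (λ t → ∣ t ∣ ≤ ∣ a ℚ.- c ∣ ℚ.+ ∣ b ℚ.- d ∣) (+-diff a b c d)
      (ℚₚ.∣p+q∣≤∣p∣+∣q∣ (a ℚ.- c) (b ℚ.- d)))
    (subst (∣ a ℚ.- c ∣ ℚ.+ ∣ b ℚ.- d ∣ <_) (halves ε) (ℚₚ.+-mono-< ac bd))

  neg-close : ∀ {ε} a b → ∣ a ℚ.- b ∣ < ε → ∣ (ℚ.- a) ℚ.- (ℚ.- b) ∣ < ε
  neg-close {ε} a b = subst (_< ε)
    (trans (sym (ℚₚ.∣-p∣≡∣p∣ (a ℚ.- b))) (cong ∣_∣ (neg-diff a b)))

  near-bound : ∀ a b → ∣ a ℚ.- b ∣ < 1ℚ → ∣ a ∣ ≤ 1ℚ ℚ.+ ∣ b ∣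
  near-bound a b a~b = ℚₚ.≤-trans
    (subst (λ t → ∣ t ∣ ≤ ∣ a ℚ.- b ∣ ℚ.+ ∣ b ∣) (sym (recover a b))
      (ℚₚ.∣p+q∣≤∣p∣+∣q∣ (a ℚ.- b) b))
    (ℚₚ.+-monoˡ-≤ ∣ b ∣ (ℚₚ.<⇒≤ a~b))

  *-close : ∀ {ε η K L} a b c d →
            K ℚ.* η ≡ ½ ℚ.* ε → ∀ {θ} → θ ℚ.* L ≡ ½ ℚ.* ε → 0ℚ < K → 0ℚ < L →
            ∣ a ∣ ≤ K → ∣ d ∣ ≤ L → ∣ b ℚ.- d ∣ < η → ∣ a ℚ.- c ∣ < θ →
            ∣ a ℚ.* b ℚ.- c ℚ.* d ∣ < ε
  *-close {ε} {η} {K} {L} a b c d Kη {θ} θL 0<K 0<L a≤K d≤L bd ac = ℚₚ.≤-<-trans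
    (subst₂ _≤_ (cong ∣_∣ (*-diff a b c d))
      (cong₂ ℚ._+_ (ℚₚ.∣p*q∣≡∣p∣*∣q∣ a (b ℚ.- d)) (ℚₚ.∣p*q∣≡∣p∣*∣q∣ (a ℚ.- c) d))
      (ℚₚ.∣p+q∣≤∣p∣+∣q∣ (a ℚ.* (b ℚ.- d)) ((a ℚ.- c) ℚ.* d)))
    (subst (∣ a ∣ ℚ.* ∣ b ℚ.- d ∣ ℚ.+ ∣ a ℚ.- c ∣ ℚ.* ∣ d ∣ <_) (halves ε)
      (ℚₚ.+-mono-< first second))
    where
    first : ∣ a ∣ ℚ.* ∣ b ℚ.- d ∣ < ½ ℚ.* ε
    first = subst (∣ a ∣ ℚ.* ∣ b ℚ.- d ∣ <_) Kη (ℚₚ.≤-<-trans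
      (ℚₚ.*-monoʳ-≤-nonNeg ∣ b ℚ.- d ∣ {{nonNegative (ℚₚ.0≤∣p∣ (b ℚ.- d))}} a≤K)
      (ℚₚ.*-monoʳ-<-pos K {{positive 0<K}} bd))
    second : ∣ a ℚ.- c ∣ ℚ.* ∣ d ∣ < ½ ℚ.* ε
    second = subst (∣ a ℚ.- c ∣ ℚ.* ∣ d ∣ <_) θL (ℚₚ.≤-<-trans
      (ℚₚ.*-monoˡ-≤-nonNeg ∣ a ℚ.- c ∣ {{nonNegative (ℚₚ.0≤∣p∣ (a ℚ.- c))}} d≤L)
      (ℚₚ.*-monoˡ-<-pos L {{positive 0<L}} ac))

  quotient : ∀ {K ε} → 0ℚ < K → 0ℚ < ε → ∃[ η ] 0ℚ < η × K ℚ.* η ≡ ε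
  quotient {K} {ε} 0<K 0<ε = 1/K ℚ.* ε , *-pos 0<1/K 0<ε ,
    trans (sym (ℚₚ.*-assoc K 1/K ε))
      (trans (cong (ℚ._* ε) (ℚₚ.*-inverseʳ K {{K≢0}})) (ℚₚ.*-identityˡ ε))
    where
    K≢0 = ℚ.>-nonZero 0<K
    1/K = (ℚ.1/ K) {{K≢0}}
    0<1/K : 0ℚ < 1/K
    0<1/K = ℚₚ.positive⁻¹ 1/K {{ℚₚ.1/pos⇒pos K {{positive 0<K}}}}

open Estimates using (*-pos; half-pos)

-- Real numbers are Cauchy sequences of rationals, with _≈ᵣ_ as their equality.

Eventually : (ℕ → Set) → Set
Eventually P = ∃[ N ] (∀ n → N ℕ.≤ n → P n)

IsCauchy : (ℕ → ℚ) → Set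
IsCauchy x = ∀ ε → 0ℚ < ε →
  ∃[ N ] (∀ m n → N ℕ.≤ m → N ℕ.≤ n → ℚ.∣ x m ℚ.- x n ∣ < ε)

record ℝ : Set where
  no-eta-equality
  constructor mkℝ
  field
    seq    : ℕ → ℚ
    cauchy : IsCauchy seq

open ℝ public

infix 4 _≈ᵣ_ _#ᵣ_

record _≈ᵣ_ (x y : ℝ) : Set where
  constructor mk≈
  field
    close : ∀ ε → 0ℚ < ε → Eventually λ n → ℚ.∣ seq x n ℚ.- seq y n ∣ < ε

-- Inequality of reals, in the positive form under which division is defined.
_#ᵣ_ : ℝ → ℝ → Set
x #ᵣ y = ∃[ δ ] 0ℚ < δ × Eventually λ n → δ ≤ ℚ.∣ seq x n ℚ.- seq y n ∣

fromℚ : ℚ → ℝ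
fromℚ q = mkℝ (λ _ → q) λ ε 0<ε →
  0 , λ _ _ _ _ → subst (λ t → ℚ.∣ t ∣ < ε) (sym (ℚₚ.+-inverseʳ q)) 0<ε

0ᵣ 1ᵣ 3ᵣ : ℝ
0ᵣ = fromℚ 0ℚ
1ᵣ = fromℚ 1ℚ
3ᵣ = fromℚ (+ 3 ℚ./ 1)

infixl 6 _+ᵣ_ _-ᵣ_
infixl 7 _*ᵣ_ _/ᵣ_[_]
infix  8 -ᵣ_

_+ᵣ_ : ℝ → ℝ → ℝ
seq    (x +ᵣ y) n = seq x n ℚ.+ seq y n
cauchy (x +ᵣ y) ε 0<ε
  with M , x-close ← cauchy x (½ ℚ.* ε) (half-pos 0<ε)
     | N , y-close ← cauchy y (½ ℚ.* ε) (half-pos 0<ε)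
  = M ℕ.⊔ N , λ m n m≥ n≥ →
    Estimates.+-close (seq x m) (seq y m) (seq x n) (seq y n)
      (x-close m n (ℕₚ.m⊔n≤o⇒m≤o M N m≥) (ℕₚ.m⊔n≤o⇒m≤o M N n≥))
      (y-close m n (ℕₚ.m⊔n≤o⇒n≤o M N m≥) (ℕₚ.m⊔n≤o⇒n≤o M N n≥))

-ᵣ_ : ℝ → ℝ
seq    (-ᵣ x) n = ℚ.- seq x n
cauchy (-ᵣ x) ε 0<ε with N , close ← cauchy x ε 0<ε
  = N , λ m n m≥ n≥ → Estimates.neg-close (seq x m) (seq x n) (close m n m≥ n≥)

_-ᵣ_ : ℝ → ℝ → ℝ
x -ᵣ y = x +ᵣ (-ᵣ y)

bounded : ∀ x → ∃[ K ] 0ℚ < K × Eventually λ n → ℚ.∣ seq x n ∣ ≤ K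
bounded x with N , close ← cauchy x 1ℚ (ℚₚ.positive⁻¹ 1ℚ)
  = 1ℚ ℚ.+ ℚ.∣ seq x N ∣
  , ℚₚ.+-mono-<-≤ (ℚₚ.positive⁻¹ 1ℚ) (ℚₚ.0≤∣p∣ (seq x N))
  , N , λ n n≥ → Estimates.near-bound (seq x n) (seq x N) (close n N n≥ ℕₚ.≤-refl)

private
  *-cauchy : ∀ {x y K L A B} → 0ℚ < K → 0ℚ < L →
             (∀ n → A ℕ.≤ n → ℚ.∣ x n ∣ ≤ K) → (∀ n → B ℕ.≤ n → ℚ.∣ y n ∣ ≤ L) →
             IsCauchy x → IsCauchy y → IsCauchy (λ n → x n ℚ.* y n)
  *-cauchy {x} {y} {K} {L} {A} {B} 0<K 0<L x≤K y≤L x-cauchy y-cauchy ε 0<ε =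
    conclude (Estimates.quotient 0<K (half-pos 0<ε)) (Estimates.quotient 0<L (half-pos 0<ε))
    where
    Close : (ℕ → ℚ) → ℚ → Set
    Close z ε = ∃[ N ] (∀ m n → N ℕ.≤ m → N ℕ.≤ n → ℚ.∣ z m ℚ.- z n ∣ < ε)

    combine : ∀ {η θ} → K ℚ.* η ≡ ½ ℚ.* ε → L ℚ.* θ ≡ ½ ℚ.* ε →
              Close x θ → Close y η → Close (λ n → x n ℚ.* y n) ε
    combine {η} {θ} Kη Lθ (C , x-close) (D , y-close) =
      (A ℕ.⊔ B) ℕ.⊔ (C ℕ.⊔ D) , λ m n m≥ n≥ →
        Estimates.*-close {ε} {η} {K} {L} (x m) (y m) (x n) (y n)
          Kη (trans (ℚₚ.*-comm θ L) Lθ) 0<K 0<L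
          (x≤K m (ℕₚ.m⊔n≤o⇒m≤o A B (ℕₚ.m⊔n≤o⇒m≤o (A ℕ.⊔ B) (C ℕ.⊔ D) m≥)))
          (y≤L n (ℕₚ.m⊔n≤o⇒n≤o A B (ℕₚ.m⊔n≤o⇒m≤o (A ℕ.⊔ B) (C ℕ.⊔ D) n≥)))
          (y-close m n
            (ℕₚ.m⊔n≤o⇒n≤o C D (ℕₚ.m⊔n≤o⇒n≤o (A ℕ.⊔ B) (C ℕ.⊔ D) m≥))
            (ℕₚ.m⊔n≤o⇒n≤o C D (ℕₚ.m⊔n≤o⇒n≤o (A ℕ.⊔ B) (C ℕ.⊔ D) n≥)))
          (x-close m n
            (ℕₚ.m⊔n≤o⇒m≤o C D (ℕₚ.m⊔n≤o⇒n≤o (A ℕ.⊔ B) (C ℕ.⊔ D) m≥))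
            (ℕₚ.m⊔n≤o⇒m≤o C D (ℕₚ.m⊔n≤o⇒n≤o (A ℕ.⊔ B) (C ℕ.⊔ D) n≥)))

    conclude : (∃[ η ] 0ℚ < η × K ℚ.* η ≡ ½ ℚ.* ε) → (∃[ θ ] 0ℚ < θ × L ℚ.* θ ≡ ½ ℚ.* ε) →
               Close (λ n → x n ℚ.* y n) ε
    conclude (η , 0<η , Kη) (θ , 0<θ , Lθ) = combine Kη Lθ (x-cauchy θ 0<θ) (y-cauchy η 0<η)

  *-cauchy-bounded : ∀ x y →
    (∃[ K ] 0ℚ < K × Eventually λ n → ℚ.∣ seq x n ∣ ≤ K) →
    (∃[ L ] 0ℚ < L × Eventually λ n → ℚ.∣ seq y n ∣ ≤ L) →
    IsCauchy (λ n → seq x n ℚ.* seq y n)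
  *-cauchy-bounded x y (K , 0<K , A , x≤K) (L , 0<L , B , y≤L) =
    *-cauchy 0<K 0<L x≤K y≤L (cauchy x) (cauchy y)

_*ᵣ_ : ℝ → ℝ → ℝ
seq    (x *ᵣ y) n = seq x n ℚ.* seq y n
cauchy (x *ᵣ y)   = *-cauchy-bounded x y (bounded x) (bounded y)

-- The value at 0 is irrelevant: a sequence apart from 0 vanishes at most finitely often.
invℚ : ℚ → ℚ
invℚ q with q ℚ.≟ 0ℚ
... | yes _   = 0ℚ
... | no q≢0 = (ℚ.1/ q) {{≢-nonZero q≢0}}

invℚ-inverse : ∀ q → q ≢ 0ℚ → q ℚ.* invℚ q ≡ 1ℚ
invℚ-inverse q q≢0 with q ℚ.≟ 0ℚ
... | yes q≡0 = contradiction q≡0 q≢0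
... | no q≢0′ = ℚₚ.*-inverseʳ q {{≢-nonZero q≢0′}}

private
  inv-diff : ∀ {a b} → a ≢ 0ℚ → b ≢ 0ℚ →
             (invℚ a ℚ.- invℚ b) ℚ.* (a ℚ.* b) ≡ b ℚ.- a
  inv-diff {a} {b} a≢0 b≢0 = trans (shuffle a b (invℚ a) (invℚ b))
    (trans (cong₂ (λ u v → u ℚ.* b ℚ.- v ℚ.* a) (invℚ-inverse a a≢0) (invℚ-inverse b b≢0))
      (cong₂ ℚ._-_ (ℚₚ.*-identityˡ b) (ℚₚ.*-identityˡ a)))
    where
    open +-*-Solver
    shuffle : ∀ a b u v → (u ℚ.- v) ℚ.* (a ℚ.* b) ≡ (a ℚ.* u) ℚ.* b ℚ.- (b ℚ.* v) ℚ.* a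
    shuffle = solve 4 (λ a b u v →
      (u :- v) :* (a :* b) := (a :* u) :* b :- (b :* v) :* a) refl

  inv-close : ∀ {ε δ} a b → 0ℚ < δ → δ ≤ ℚ.∣ a ∣ → δ ≤ ℚ.∣ b ∣ →
              ℚ.∣ b ℚ.- a ∣ < ε ℚ.* (δ ℚ.* δ) → ℚ.∣ invℚ a ℚ.- invℚ b ∣ < ε
  inv-close {ε} {δ} a b 0<δ δ≤a δ≤b close =
    ℚₚ.*-cancelʳ-<-nonNeg (δ ℚ.* δ) {{nonNegative (ℚₚ.<⇒≤ (*-pos 0<δ 0<δ))}}
      (ℚₚ.≤-<-trans scaled close)
    where
    d = invℚ a ℚ.- invℚ b
    ≢0 : ∀ {q} → δ ≤ ℚ.∣ q ∣ → q ≢ 0ℚ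
    ≢0 δ≤q = Estimates.pos⇒≢0 (ℚₚ.<-≤-trans 0<δ δ≤q)
    scaled : ℚ.∣ d ∣ ℚ.* (δ ℚ.* δ) ≤ ℚ.∣ b ℚ.- a ∣
    scaled = subst (ℚ.∣ d ∣ ℚ.* (δ ℚ.* δ) ≤_)
      (trans (cong (ℚ.∣ d ∣ ℚ.*_) (sym (ℚₚ.∣p*q∣≡∣p∣*∣q∣ a b)))
        (trans (sym (ℚₚ.∣p*q∣≡∣p∣*∣q∣ d (a ℚ.* b)))
          (cong ℚ.∣_∣ (inv-diff (≢0 δ≤a) (≢0 δ≤b)))))
      (ℚₚ.*-monoˡ-≤-nonNeg ℚ.∣ d ∣ {{nonNegative (ℚₚ.0≤∣p∣ d)}}
        (Estimates.*-mono-≤ (ℚₚ.<⇒≤ 0<δ) (ℚₚ.0≤∣p∣ a) δ≤a δ≤b))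

invᵣ : (x : ℝ) → x #ᵣ 0ᵣ → ℝ
seq    (invᵣ x _) n = invℚ (seq x n)
cauchy (invᵣ x (δ , 0<δ , M , x≥δ)) ε 0<ε
  with N , close ← cauchy x (ε ℚ.* (δ ℚ.* δ)) (*-pos 0<ε (*-pos 0<δ 0<δ))
  = M ℕ.⊔ N , λ m n m≥ n≥ →
    inv-close (seq x m) (seq x n) 0<δ
      (δ≤ m (ℕₚ.m⊔n≤o⇒m≤o M N m≥)) (δ≤ n (ℕₚ.m⊔n≤o⇒m≤o M N n≥))
      (close n m (ℕₚ.m⊔n≤o⇒n≤o M N n≥) (ℕₚ.m⊔n≤o⇒n≤o M N m≥))
  where
  δ≤ : ∀ n → M ℕ.≤ n → δ ≤ ℚ.∣ seq x n ∣
  δ≤ n n≥ = subst (λ t → δ ≤ ℚ.∣ t ∣) (ℚₚ.+-identityʳ (seq x n)) (x≥δ n n≥)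

_/ᵣ_[_] : ℝ → (y : ℝ) → y #ᵣ 0ᵣ → ℝ
x /ᵣ y [ y#0 ] = x *ᵣ invᵣ y y#0

ℝ-rawRing : RawRing 0ℓ 0ℓ
ℝ-rawRing = record
  { Carrier = ℝ ; _≈_ = _≈ᵣ_ ; _+_ = _+ᵣ_ ; _*_ = _*ᵣ_ ; -_ = -ᵣ_ ; 0# = 0ᵣ ; 1# = 1ᵣ }

open import Algebra.Definitions.RawSemiring (RawRing.rawSemiring ℝ-rawRing) public
  using () renaming (_^_ to infixr 8 _^ᵣ_)

infixr 4 _+i_

record ℂ : Set where
  constructor _+i_
  field
    re im : ℝ

open ℂ public

infix  4 _≈_ _#_
infixl 6 _+_ _-_
infixl 7 _*_ _/_[_]
infix  8 -_

_≈_ : ℂ → ℂ → Set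
z ≈ w = re z ≈ᵣ re w × im z ≈ᵣ im w

_#_ : ℂ → ℂ → Set
z # w = re z #ᵣ re w ⊎ im z #ᵣ im w

ι : ℝ → ℂ
ι x = x +i 0ᵣ

0ℂ 1ℂ : ℂ
0ℂ = ι 0ᵣ
1ℂ = ι 1ᵣ

_+_ : ℂ → ℂ → ℂ
z + w = (re z +ᵣ re w) +i (im z +ᵣ im w)

-_ : ℂ → ℂ
- z = (-ᵣ re z) +i (-ᵣ im z)

_-_ : ℂ → ℂ → ℂ
z - w = z + (- w)

_*_ : ℂ → ℂ → ℂ
z * w = (re z *ᵣ re w -ᵣ im z *ᵣ im w) +i (re z *ᵣ im w +ᵣ im z *ᵣ re w)

∣_∣² : ℂ → ℝ
∣ z ∣² = re z *ᵣ re z +ᵣ im z *ᵣ im z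

private
  0≤square : ∀ q → 0ℚ ≤ q ℚ.* q
  0≤square q with ℚₚ.≤-total 0ℚ q
  ... | inj₁ 0≤q = Estimates.*-mono-≤ ℚₚ.≤-refl 0≤q 0≤q 0≤q
  ... | inj₂ q≤0 = subst (_≤ q ℚ.* q) (ℚₚ.*-zeroʳ q)
                     (ℚₚ.*-monoˡ-≤-nonPos q {{nonPositive q≤0}} q≤0)

  square : ∀ q → q ℚ.* q ≡ ℚ.∣ q ∣ ℚ.* ℚ.∣ q ∣
  square q = trans (sym (ℚₚ.0≤p⇒∣p∣≡p (0≤square q))) (ℚₚ.∣p*q∣≡∣p∣*∣q∣ q q)

  square-bound : ∀ {δ} a → 0ℚ < δ → δ ≤ ℚ.∣ a ℚ.- 0ℚ ∣ → δ ℚ.* δ ≤ a ℚ.* a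
  square-bound {δ} a 0<δ δ≤ = subst (δ ℚ.* δ ≤_) (sym (square a))
    (Estimates.*-mono-≤ (ℚₚ.<⇒≤ 0<δ) (ℚₚ.0≤∣p∣ a) δ≤a δ≤a)
    where δ≤a = subst (λ t → δ ≤ ℚ.∣ t ∣) (ℚₚ.+-identityʳ a) δ≤

  ≤-∣-0∣ : ∀ {p} q → p ≤ q → p ≤ ℚ.∣ q ℚ.- 0ℚ ∣
  ≤-∣-0∣ {p} q p≤q = subst (λ t → p ≤ ℚ.∣ t ∣) (sym (ℚₚ.+-identityʳ q)) (ℚₚ.≤-trans p≤q (≤∣∣ q))
    where
    ≤∣∣ : ∀ q → q ≤ ℚ.∣ q ∣
    ≤∣∣ q with ℚₚ.≤-total 0ℚ q
    ... | inj₁ 0≤q = ℚₚ.≤-reflexive (sym (ℚₚ.0≤p⇒∣p∣≡p 0≤q))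
    ... | inj₂ q≤0 = ℚₚ.≤-trans q≤0 (ℚₚ.0≤∣p∣ q)

#0⇒∣∣²#0 : ∀ z → z # 0ℂ → ∣ z ∣² #ᵣ 0ᵣ
#0⇒∣∣²#0 (x +i y) (inj₁ (δ , 0<δ , N , x≥δ)) = δ ℚ.* δ , *-pos 0<δ 0<δ , N , λ n n≥ →
  let a = seq x n ; b = seq y n in
  ≤-∣-0∣ (a ℚ.* a ℚ.+ b ℚ.* b) (subst (_≤ a ℚ.* a ℚ.+ b ℚ.* b) (ℚₚ.+-identityʳ (δ ℚ.* δ))
    (ℚₚ.+-mono-≤ (square-bound a 0<δ (x≥δ n n≥)) (0≤square b)))
#0⇒∣∣²#0 (x +i y) (inj₂ (δ , 0<δ , N , y≥δ)) = δ ℚ.* δ , *-pos 0<δ 0<δ , N , λ n n≥ →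
  let a = seq x n ; b = seq y n in
  ≤-∣-0∣ (a ℚ.* a ℚ.+ b ℚ.* b) (subst (_≤ a ℚ.* a ℚ.+ b ℚ.* b) (ℚₚ.+-identityˡ (δ ℚ.* δ))
    (ℚₚ.+-mono-≤ (0≤square a) (square-bound b 0<δ (y≥δ n n≥))))

inv : (z : ℂ) → z # 0ℂ → ℂ
inv z z#0 = (re z /ᵣ ∣ z ∣² [ n#0 ]) +i (-ᵣ im z /ᵣ ∣ z ∣² [ n#0 ])
  where n#0 = #0⇒∣∣²#0 z z#0

_/_[_] : ℂ → (w : ℂ) → w # 0ℂ → ℂ
z / w [ w#0 ] = z * inv w w#0

ℂ-rawRing : RawRing 0ℓ 0ℓ
ℂ-rawRing = record
  { Carrier = ℂ ; _≈_ = _≈_ ; _+_ = _+_ ; _*_ = _*_ ; -_ = -_ ; 0# = 0ℂ ; 1# = 1ℂ }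

open import Algebra.Definitions.RawSemiring (RawRing.rawSemiring ℂ-rawRing) public
  using (_^_)

⟅_,_,_⟆ : ℂ → ℂ → ℂ → Pred ℂ 0ℓ
⟅ a , b , c ⟆ z = z ≈ a ⊎ z ≈ b ⊎ z ≈ c

infixr 7 _·_

_·_ : ℂ → Pred ℂ 0ℓ → Pred ℂ 0ℓ
(c · Z) w = ∃[ z ] Z z × w ≈ c * z

-- x³ + p x² + q x + r
record Cubic : Set where
  constructor cubic
  field
    p q r : ℝ

infix 4 _≋_

_≋_ : Cubic → Cubic → Set
cubic p q r ≋ cubic p′ q′ r′ = p ≈ᵣ p′ × q ≈ᵣ q′ × r ≈ᵣ r′

eval : Cubic → ℂ → ℂ
eval (cubic p q r) x = x ^ 3 + ι p * x ^ 2 + ι q * x + ι r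

zeros : Cubic → Pred ℂ 0ℓ
zeros f x = eval f x ≈ 0ℂ

-- The field ∛r is determined by r up to _≈ᵣ_, real cube roots being unique.
record RamanujanCubic : Set where
  field
    polynomial : Cubic
  open Cubic polynomial public
  field
    r≠0        : r #ᵣ 0ᵣ
    zeros-real : ∀ z → zeros polynomial z → im z ≈ᵣ 0ᵣ
    ∛r         : ℝ
    ∛r-cubed   : ∛r ^ᵣ 3 ≈ᵣ r
    condition  : p *ᵣ ∛r +ᵣ 3ᵣ *ᵣ ∛r ^ᵣ 2 +ᵣ q ≈ᵣ 0ᵣ

ρ : ℝ → ℝ → Cubic
ρ h s = cubic (h *ᵣ s) (-ᵣ ((h +ᵣ 3ᵣ) *ᵣ s ^ᵣ 2)) (s ^ᵣ 3)

ζ : ℝ → ℝ → Pred ℂ 0ℓ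
ζ h s = zeros (ρ h s)

η : (s : ℝ) (z : ℂ) → (ι s - z) # 0ℂ → ℂ
η s z s-z#0 = ι s ^ 2 / (ι s - z) [ s-z#0 ]

{-# OPTIONS --safe #-}

-- Fix a zero a of the cubic and put N = a² − a s + s². Up to unit factors the pairwise differences
-- of a, s²/(s − a) and −s(s − a)/a are all equal to N, and N³ = (h² + 3 h + 9) (s a (s − a))² modulo
-- the equation of a. Since h is real, h² + 3 h + 9 ≥ 27/4, so the three zeros are apart from each
-- other; the factorisation of the cubic then decides constructively which of them a given zero is.
-- Being apart from 0 means being invertible, so all of this is algebra over a local ring.

module Submission where

open import Algebra.Bundles using (CommutativeRing)
import Algebra.Properties.Group as GroupProperties
import Algebra.Properties.Ring as RingProperties
open import Algebra.Solver.Ring.AlmostCommutativeRing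
  using (fromCommutativeRing; _-Raw-AlmostCommutative⟶_)
open import Algebra.Structures using (IsCommutativeRing)
open import Data.Integer.Base using (+_)
open import Data.Maybe.Base using (map)
open import Data.Nat.Base as ℕ using (ℕ; zero; suc)
import Data.Nat.Properties as ℕₚ
open import Data.Product using (_×_; _,_; ∃-syntax; Σ-syntax)
open import Data.Rational using (ℚ; 0ℚ; 1ℚ; ½; positive; nonNegative; nonPositive)
import Data.Rational as ℚ
import Data.Rational.Properties as ℚₚ
import Data.Rational.Solver as ℚSolver
open import Data.Sum using (_⊎_; inj₁; inj₂)
import Data.Sum as Sum
open import Function.Base using (_∘_)
open import Relation.Binary.Consequences using (dec⇒weaklyDec)
open import Relation.Binary.PropositionalEquality as ≡ using (_≡_)
open import Relation.Nullary using (yes; no; contradiction)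
open import Relation.Unary using (_∈_; _≐_)

-- Units and the Ramanujan cubic over a commutative ring with rational scalars

module LocalAlgebra {c ℓ} (R : CommutativeRing c ℓ)
  (scalar : CommutativeRing.rawRing ℚₚ.+-*-commutativeRing
            -Raw-AlmostCommutative⟶ fromCommutativeRing R)
  where

  open CommutativeRing R
  open import Algebra.Properties.Group +-group using (x∙y⁻¹≈ε⇒x≈y; x≈y⇒x∙y⁻¹≈ε)
  open import Algebra.Properties.Semiring.Exp semiring using (_^_; ^-congˡ)
  open _-Raw-AlmostCommutative⟶_ scalar using (⟦_⟧)
  open import Algebra.Solver.Ring
    (CommutativeRing.rawRing ℚₚ.+-*-commutativeRing) (fromCommutativeRing R) scalar
    (λ p q → map (reflexive ∘ ≡.cong ⟦_⟧) (dec⇒weaklyDec ℚ._≟_ p q))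
    using (Polynomial; solve; con; _:+_; _:*_; _:-_; :-_; _:^_; _:=_)
  open import Relation.Binary.Reasoning.Setoid setoid

  Unit : Carrier → Set _
  Unit x = ∃[ y ] x * y ≈ 1#

  unit-resp : ∀ {x y} → x ≈ y → Unit x → Unit y
  unit-resp x≈y (u , xu≈1) = u , trans (*-congʳ (sym x≈y)) xu≈1

  unit-* : ∀ {x y} → Unit x → Unit y → Unit (x * y)
  unit-* {x} {y} (u , xu≈1) (v , yv≈1) = u * v , (begin
    x * y * (u * v)   ≈⟨ solve 4 (λ x y u v → x :* y :* (u :* v) := x :* u :* (y :* v)) refl x y u v ⟩
    x * u * (y * v)   ≈⟨ *-cong xu≈1 yv≈1 ⟩
    1# * 1#           ≈⟨ *-identityʳ 1# ⟩
    1#                ∎)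

  unit-^ : ∀ {x} → Unit x → ∀ n → Unit (x ^ n)
  unit-^ Ux zero = 1# , *-identityʳ 1#
  unit-^ Ux (suc n) = unit-* Ux (unit-^ Ux n)

  unit-factorˡ : ∀ {x y} → Unit (x * y) → Unit x
  unit-factorˡ {x} {y} (u , xyu≈1) = y * u , trans (sym (*-assoc x y u)) xyu≈1

  unit-factorʳ : ∀ {x y} → Unit (x * y) → Unit y
  unit-factorʳ {x} {y} = unit-factorˡ ∘ unit-resp (*-comm x y)

  unit-neg : ∀ {x} → Unit x → Unit (- x)
  unit-neg {x} (u , xu≈1) =
    - u , trans (solve 2 (λ x u → :- x :* :- u := x :* u) refl x u) xu≈1

  *-cancelˡ-unit : ∀ {k x y} → Unit k → k * x ≈ k * y → x ≈ y
  *-cancelˡ-unit {k} {x} {y} (u , ku≈1) kx≈ky = begin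
    x             ≈⟨ *-identityˡ x ⟨
    1# * x        ≈⟨ *-congʳ ku≈1 ⟨
    k * u * x     ≈⟨ swap x ⟩
    u * (k * x)   ≈⟨ *-congˡ kx≈ky ⟩
    u * (k * y)   ≈⟨ swap y ⟨
    k * u * y     ≈⟨ *-congʳ ku≈1 ⟩
    1# * y        ≈⟨ *-identityˡ y ⟩
    y             ∎
    where
    swap : ∀ x → k * u * x ≈ u * (k * x)
    swap = solve 3 (λ k u x → k :* u :* x := u :* (k :* x)) refl k u

  unit*x≈0⇒x≈0 : ∀ {k x} → Unit k → k * x ≈ 0# → x ≈ 0#
  unit*x≈0⇒x≈0 {k} Uk kx≈0 = *-cancelˡ-unit Uk (trans kx≈0 (sym (zeroʳ k)))

  x≈0⇒k*x≈0 : ∀ k {x} → x ≈ 0# → k * x ≈ 0#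
  x≈0⇒k*x≈0 k x≈0 = trans (*-congˡ x≈0) (zeroʳ k)

  -- This is how equational hypotheses enter identities checked by the ring solver.
  drop-multiple : ∀ {x y z} k → z ≈ 0# → x ≈ y + k * z → x ≈ y
  drop-multiple {x} {y} k z≈0 x≈y+kz =
    trans x≈y+kz (trans (+-congˡ (x≈0⇒k*x≈0 k z≈0)) (+-identityʳ y))

  -- Since `b - a` is the sum of `x - a` and `b - x`, locality makes `x - a` or `x - b` a unit.
  -- Cancelling that factor leaves a product of two factors, and the same argument, applied to the
  -- two points that remain, cancels one more.
  distinct-zeros : (∀ {x y} → Unit (x + y) → Unit x ⊎ Unit y) →
    ∀ {a b c} → Unit (b - a) → Unit (c - a) → Unit (c - b) →
    ∀ {x} → (x - a) * (x - b) * (x - c) ≈ 0# → x ≈ a ⊎ x ≈ b ⊎ x ≈ c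
  distinct-zeros local {a} {b} {c} b≠a c≠a c≠b {x} abc≈0 =
    Sum.[ (λ x≠a → inj₂ (pick c≠b (unit*x≈0⇒x≈0 x≠a (trans (sym (*-assoc _ _ _)) abc≈0))))
        , (λ x≠b → Sum.map₂ inj₂ (pick c≠a (unit*x≈0⇒x≈0 x≠b (trans (front (x - b) (x - a) (x - c)) abc≈0))))
        ]′ (split b≠a)
    where
    front : ∀ u v w → u * (v * w) ≈ v * u * w
    front = solve 3 (λ u v w → u :* (v :* w) := v :* u :* w) refl

    split : ∀ {u v} → Unit (v - u) → Unit (x - u) ⊎ Unit (x - v)
    split {u} {v} v≠u = Sum.map₂ (unit-resp negate ∘ unit-neg) (local (unit-resp rearrange v≠u))
      where
      negate : - (v - x) ≈ x - v
      negate = solve 2 (λ v x → :- (v :- x) := x :- v) refl v x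
      rearrange : v - u ≈ (x - u) + (v - x)
      rearrange = solve 3 (λ u v x → v :- u := (x :- u) :+ (v :- x)) refl u v x

    pick : ∀ {u v} → Unit (v - u) → (x - u) * (x - v) ≈ 0# → x ≈ u ⊎ x ≈ v
    pick {u} {v} v≠u uv≈0 = Sum.[
      (λ x≠u → inj₂ (x∙y⁻¹≈ε⇒x≈y x v (unit*x≈0⇒x≈0 x≠u uv≈0))) ,
      (λ x≠v → inj₁ (x∙y⁻¹≈ε⇒x≈y x u (unit*x≈0⇒x≈0 x≠v (trans (*-comm _ _) uv≈0)))) ]′ (split v≠u)

  3# 9# : Carrier
  3# = ⟦ + 3 ℚ./ 1 ⟧
  9# = ⟦ + 9 ℚ./ 1 ⟧

  poly : Carrier → Carrier → Carrier → Carrier → Carrier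
  poly p q r x = x ^ 3 + p * x ^ 2 + q * x + r

  poly-cong : ∀ {p p′ q q′ r r′ x x′} → p ≈ p′ → q ≈ q′ → r ≈ r′ → x ≈ x′ →
              poly p q r x ≈ poly p′ q′ r′ x′
  poly-cong p≈ q≈ r≈ x≈ =
    +-cong (+-cong (+-cong (^-congˡ 3 x≈) (*-cong p≈ (^-congˡ 2 x≈))) (*-cong q≈ x≈)) r≈

  F : Carrier → Carrier → Carrier → Carrier
  F h s = poly (h * s) (- ((h + 3#) * s ^ 2)) (s ^ 3)

  F-cong : ∀ h {s t x y} → s ≈ t → x ≈ y → F h s x ≈ F h t y
  F-cong h s≈t x≈y = poly-cong (*-congˡ s≈t) (-‿cong (*-congˡ (^-congˡ 2 s≈t))) (^-congˡ 3 s≈t) x≈y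

  private
    :3 :9 : ∀ {n} → Polynomial n
    :3 = con (+ 3 ℚ./ 1)
    :9 = con (+ 9 ℚ./ 1)

    :F : ∀ {n} → Polynomial n → Polynomial n → Polynomial n → Polynomial n
    :F h s x = x :^ 3 :+ h :* s :* x :^ 2 :+ :- ((h :+ :3) :* s :^ 2) :* x :+ s :^ 3

  -- For fixed `h` the form `F h s x` is homogeneous of degree 3 in `s` and `x` together. Scaling
  -- the pair (-1, `x`) by `- s` gives (`s`, `- s * x`), which brings out the factor (-s)³ = -s³.
  F-homothety : ∀ h s x → F h s (- s * x) ≈ - s ^ 3 * F h (- ⟦ ℚ.1ℚ ⟧) x
  F-homothety = solve 3 (λ h s x →
    :F h s (:- s :* x) := (:- (s :^ 3)) :* :F h (:- con ℚ.1ℚ) x) refl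

  module Zeros {h s a : Carrier} (s-unit : Unit s)
    (disc-unit : Unit (h * h + 3# * h + 9#)) (Fa≈0 : F h s a ≈ 0#) where

    -- The equation of `a` exhibits `a` as a divisor of the constant term `s ^ 3`, which is a unit.
    a-unit : Unit a
    a-unit = unit-factorˡ (unit-resp (sym (drop-multiple _ Fa≈0
      (solve 3 (λ h s a →
        a :* :- (a :^ 2 :+ h :* s :* a :- (h :+ :3) :* s :^ 2)
          := s :^ 3 :+ (:- con ℚ.1ℚ) :* :F h s a) refl h s a)))
      (unit-^ s-unit 3))

    -- The value of the cubic at `s` is -s³ for every `h`, and `s - a` divides the difference of the
    -- values at `s` and at `a`. As the value at `a` is 0, `s - a` divides the unit `s ^ 3`. The
    -- cofactor below is the negated difference quotient.
    s-a-unit : Unit (s - a)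
    s-a-unit = unit-factorˡ (unit-resp (sym (drop-multiple _ Fa≈0
      (solve 3 (λ h s a →
        (s :- a) :* ((h :+ :3) :* s :^ 2 :- (s :^ 2 :+ s :* a :+ a :^ 2) :- h :* s :* (s :+ a))
          := s :^ 3 :+ con ℚ.1ℚ :* :F h s a) refl h s a)))
      (unit-^ s-unit 3))

    N : Carrier
    N = a ^ 2 - a * s + s ^ 2

    -- Up to units N³ is the product of the differences of the zeros, whose square is the
    -- discriminant (h² + 3 h + 9)² s⁶ of the cubic.
    N-unit : Unit N
    N-unit = unit-factorˡ (unit-resp (sym (drop-multiple _ Fa≈0
      (solve 3 (λ h s a →
        let N = a :^ 2 :- a :* s :+ s :^ 2
            Q = s :* a :* (s :- a)
        in N :* N :^ 2 := (h :* h :+ :3 :* h :+ :9) :* Q :^ 2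
             :+ (a :^ 3 :- :3 :* s :^ 2 :* a :+ s :^ 3 :+ (h :+ :3) :* Q) :* :F h s a)
        refl h s a)))
      (unit-* disc-unit (unit-^ (unit-* (unit-* s-unit a-unit) s-a-unit) 2)))

    -- The equation of `b` gives (s - a)(s - b) = -s a. This is what allows the map z ↦ s²/(s - z)
    -- to be applied a second time.
    s-b-unit : ∀ {b} → b * (s - a) ≈ s ^ 2 → Unit (s - b)
    s-b-unit {b} b-eq = unit-factorʳ (unit-resp (sym (drop-multiple _ (x≈y⇒x∙y⁻¹≈ε b-eq)
      (solve 3 (λ s a b →
        (s :- a) :* (s :- b) := :- (s :* a) :+ (:- con ℚ.1ℚ) :* (b :* (s :- a) :- s :^ 2))
        refl s a b)))
      (unit-neg (unit-* s-unit a-unit)))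

    module _ {b c : Carrier} (b-eq : b * (s - a) ≈ s ^ 2) (c-eq : c * a ≈ - (s * (s - a))) where

      private
        b-eq₀ : b * (s - a) - s ^ 2 ≈ 0#
        b-eq₀ = x≈y⇒x∙y⁻¹≈ε b-eq

        c-eq₀ : c * a - - (s * (s - a)) ≈ 0#
        c-eq₀ = x≈y⇒x∙y⁻¹≈ε c-eq

      -- Multiplying by the unit a (s - a) clears the denominators of `b` and `c`. What remains is a
      -- polynomial identity modulo the equations of `a`, `b` and `c`.
      factorisation : ∀ x → F h s x ≈ (x - a) * (x - b) * (x - c)
      factorisation x = *-cancelˡ-unit (unit-* a-unit s-a-unit)
        (drop-multiple _ b-eq₀ (drop-multiple _ c-eq₀ (drop-multiple _ Fa≈0
          (solve 6 (λ h s a b c x →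
            let eb = b :* (s :- a) :- s :^ 2
                ec = c :* a :- :- (s :* (s :- a))
            in a :* (s :- a) :* :F h s x :=
               -- The first three summands add up to (x - a)((s - a)(x - b) + `eb`)(a (x - c) +
               -- `ec`). Here `b` and `c` drop out: the last two factors are (s - a) x - s² and a x
               -- + s (s - a).
               a :* (s :- a) :* ((x :- a) :* (x :- b) :* (x :- c))
                 :+ (x :- a) :* (a :* (x :- c) :+ ec) :* eb
                 :+ (x :- a) :* (s :- a) :* (x :- b) :* ec
                 -- The parameter `h` enters `F h s x` only through h s x (x - s), so with the
                 -- coefficient x (s - x) the terms in `h` cancel between a (s - a) F(x) and x (s -
                 -- x) F(a). The difference of the two also vanishes at x = a, whence its factor x -
                 -- a.
                 :+ x :* (s :- x) :* :F h s a)
            refl h s a b c x))))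

      b-a-unit : Unit (b - a)
      b-a-unit = unit-factorʳ (unit-resp (sym (drop-multiple _ b-eq₀
        (solve 3 (λ s a b →
          (s :- a) :* (b :- a) := (a :^ 2 :- a :* s :+ s :^ 2) :+ con ℚ.1ℚ :* (b :* (s :- a) :- s :^ 2))
          refl s a b)))
        N-unit)

      c-a-unit : Unit (c - a)
      c-a-unit = unit-factorʳ (unit-resp (sym (drop-multiple _ c-eq₀
        (solve 3 (λ s a c →
          a :* (c :- a) :=
            :- (a :^ 2 :- a :* s :+ s :^ 2) :+ con ℚ.1ℚ :* (c :* a :- :- (s :* (s :- a))))
          refl s a c)))
        (unit-neg N-unit))

      c-b-unit : Unit (c - b)
      c-b-unit = unit-factorʳ (unit-resp (sym (drop-multiple _ b-eq₀ (drop-multiple _ c-eq₀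
        (solve 4 (λ s a b c →
          (s :- a) :* a :* (c :- b) :=
            :- (s :* (a :^ 2 :- a :* s :+ s :^ 2))
              :+ :- a :* (b :* (s :- a) :- s :^ 2)
              :+ (s :- a) :* (c :* a :- :- (s :* (s :- a))))
          refl s a b c))))
        (unit-neg (unit-* s-unit N-unit)))

      zero⇒root : (∀ {x y} → Unit (x + y) → Unit x ⊎ Unit y) →
                  ∀ {x} → F h s x ≈ 0# → x ≈ a ⊎ x ≈ b ⊎ x ≈ c
      zero⇒root local {x} Fx≈0 = distinct-zeros local b-a-unit c-a-unit c-b-unit
        (trans (sym (factorisation x)) Fx≈0)

      root⇒zero : ∀ {x} → x ≈ a ⊎ x ≈ b ⊎ x ≈ c → F h s x ≈ 0#
      root⇒zero {x} x-root = trans (factorisation x) (product≈0 x-root)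
        where
        product≈0 : x ≈ a ⊎ x ≈ b ⊎ x ≈ c → (x - a) * (x - b) * (x - c) ≈ 0#
        product≈0 (inj₁ x≈a) = trans (*-assoc _ _ _)
          (trans (*-congʳ (x≈y⇒x∙y⁻¹≈ε x≈a)) (zeroˡ _))
        product≈0 (inj₂ (inj₁ x≈b)) = trans (*-congʳ (x≈0⇒k*x≈0 _ (x≈y⇒x∙y⁻¹≈ε x≈b))) (zeroˡ _)
        product≈0 (inj₂ (inj₂ x≈c)) = x≈0⇒k*x≈0 _ (x≈y⇒x∙y⁻¹≈ε x≈c)

    -- Multiply the equation of `c` by `s - a` and substitute (s - a)(s - b) = -s a; both sides then
    -- carry a factor `s`, which is cancelled.
    second-iterate : ∀ {b c} → b * (s - a) ≈ s ^ 2 → c * (s - b) ≈ s ^ 2 → c * a ≈ - (s * (s - a))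
    second-iterate {b} {c} b-eq c-eq = *-cancelˡ-unit s-unit
      (drop-multiple _ (x≈y⇒x∙y⁻¹≈ε b-eq) (drop-multiple _ (x≈y⇒x∙y⁻¹≈ε c-eq)
        (solve 4 (λ s a b c →
          s :* (c :* a) := s :* :- (s :* (s :- a))
            :+ (:- c) :* (b :* (s :- a) :- s :^ 2)
            :+ (a :- s) :* (c :* (s :- b) :- s :^ 2))
          refl s a b c)))

open import Defs
open ≡ using (refl; sym; trans; cong; subst)
open ℚSolver.+-*-Solver using (solve; con; _:+_; _:*_; _:-_; :-_; _:=_)
open Estimates using (half-pos; halves)

-- The Cauchy reals as a commutative ring

eventually-× : ∀ {P Q : ℕ → Set} → Eventually P → Eventually Q → Eventually λ n → P n × Q n
eventually-× (M , p) (N , q) =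
  M ℕ.⊔ N , λ n n≥ → p n (ℕₚ.m⊔n≤o⇒m≤o M N n≥) , q n (ℕₚ.m⊔n≤o⇒n≤o M N n≥)

eventually-map : ∀ {P Q : ℕ → Set} → (∀ n → P n → Q n) → Eventually P → Eventually Q
eventually-map f (N , p) = N , λ n n≥ → f n (p n n≥)

-- Equality from some index on is what `*ᵣ-inverse` has to work with: finitely many terms of a
-- number apart from 0 may vanish, and there `invℚ` takes its default value 0.
eventually-≡⇒≈ᵣ : ∀ {x y} → (Eventually λ n → seq x n ≡ seq y n) → x ≈ᵣ y
eventually-≡⇒≈ᵣ {x} {y} eq = mk≈ λ ε 0<ε → eventually-map
  (λ n xn≡yn → subst (λ t → ℚ.∣ t ∣ ℚ.< ε)
    (sym (trans (cong (ℚ._- seq y n) xn≡yn) (ℚₚ.+-inverseʳ (seq y n)))) 0<ε)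
  eq

pointwise : ∀ {x y} → (∀ n → seq x n ≡ seq y n) → x ≈ᵣ y
pointwise eq = eventually-≡⇒≈ᵣ (0 , λ n _ → eq n)

∣p-q∣≡∣q-p∣ : ∀ p q → ℚ.∣ p ℚ.- q ∣ ≡ ℚ.∣ q ℚ.- p ∣
∣p-q∣≡∣q-p∣ p q = trans (sym (ℚₚ.∣-p∣≡∣p∣ (p ℚ.- q)))
  (cong ℚ.∣_∣ (solve 2 (λ p q → :- (p :- q) := q :- p) refl p q))

≈ᵣ-sym : ∀ {x y} → x ≈ᵣ y → y ≈ᵣ x
≈ᵣ-sym {x} {y} (mk≈ close) = mk≈ λ ε 0<ε → eventually-map
  (λ n → subst (ℚ._< ε) (∣p-q∣≡∣q-p∣ (seq x n) (seq y n))) (close ε 0<ε)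

+ᵣ-cong : ∀ {x y u v} → x ≈ᵣ y → u ≈ᵣ v → x +ᵣ u ≈ᵣ y +ᵣ v
+ᵣ-cong {x} {y} {u} {v} (mk≈ xy) (mk≈ uv) = mk≈ λ ε 0<ε → eventually-map
  (λ n (xy , uv) → Estimates.+-close (seq x n) (seq u n) (seq y n) (seq v n) xy uv)
  (eventually-× (xy (½ ℚ.* ε) (half-pos 0<ε)) (uv (½ ℚ.* ε) (half-pos 0<ε)))

-ᵣ-cong : ∀ {x y} → x ≈ᵣ y → -ᵣ x ≈ᵣ -ᵣ y
-ᵣ-cong {x} {y} (mk≈ xy) = mk≈ λ ε 0<ε →
  eventually-map (λ n → Estimates.neg-close (seq x n) (seq y n)) (xy ε 0<ε)

≈ᵣ-trans : ∀ {x y z} → x ≈ᵣ y → y ≈ᵣ z → x ≈ᵣ z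
≈ᵣ-trans {x} {y} {z} (mk≈ xy) (mk≈ yz) = mk≈ λ ε 0<ε → eventually-map
  (λ n (xy , yz) → subst (λ t → ℚ.∣ t ∣ ℚ.< ε) (telescope (seq x n) (seq y n) (seq z n))
    (Estimates.+-close (seq x n) (seq y n) (seq y n) (seq z n) xy yz))
  (eventually-× (xy (½ ℚ.* ε) (half-pos 0<ε)) (yz (½ ℚ.* ε) (half-pos 0<ε)))
  where
  telescope : ∀ p q r → (p ℚ.+ q) ℚ.- (q ℚ.+ r) ≡ p ℚ.- r
  telescope = solve 3 (λ p q r → (p :+ q) :- (q :+ r) := p :- r) refl

-- The error x u - y v equals x (u - v) + (x - y) v, so bounds on `x` and `v` control it; each
-- summand is kept below half of `ε`.
*ᵣ-cong : ∀ {x y u v} → x ≈ᵣ y → u ≈ᵣ v → x *ᵣ u ≈ᵣ y *ᵣ v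
*ᵣ-cong {x} {y} {u} {v} (mk≈ xy) (mk≈ uv) = mk≈ (from-bounds (bounded x) (bounded v))
  where
  from-bounds :
    (∃[ K ] 0ℚ ℚ.< K × Eventually λ n → ℚ.∣ seq x n ∣ ℚ.≤ K) →
    (∃[ L ] 0ℚ ℚ.< L × Eventually λ n → ℚ.∣ seq v n ∣ ℚ.≤ L) →
    ∀ ε → 0ℚ ℚ.< ε →
    Eventually λ n → ℚ.∣ seq x n ℚ.* seq u n ℚ.- seq y n ℚ.* seq v n ∣ ℚ.< ε
  from-bounds (K , 0<K , x≤K) (L , 0<L , v≤L) ε 0<ε =
    from-quotients (Estimates.quotient 0<K (half-pos 0<ε)) (Estimates.quotient 0<L (half-pos 0<ε))
    where
    from-quotients :
      (∃[ η ] 0ℚ ℚ.< η × K ℚ.* η ≡ ½ ℚ.* ε) → (∃[ θ ] 0ℚ ℚ.< θ × L ℚ.* θ ≡ ½ ℚ.* ε) →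
      Eventually λ n → ℚ.∣ seq x n ℚ.* seq u n ℚ.- seq y n ℚ.* seq v n ∣ ℚ.< ε
    from-quotients (η , 0<η , Kη) (θ , 0<θ , Lθ) = eventually-map
      (λ n ((x≤K , v≤L) , (xy , uv)) →
        Estimates.*-close {ε} {η} {K} {L} (seq x n) (seq u n) (seq y n) (seq v n)
          Kη {θ} (trans (ℚₚ.*-comm θ L) Lθ) 0<K 0<L x≤K v≤L uv xy)
      (eventually-× (eventually-× x≤K v≤L) (eventually-× (xy θ 0<θ) (uv η 0<η)))

ℝ-isCommutativeRing : IsCommutativeRing _≈ᵣ_ _+ᵣ_ _*ᵣ_ -ᵣ_ 0ᵣ 1ᵣ
ℝ-isCommutativeRing = record
  { isRing = record
    { +-isAbelianGroup = record
      { isGroup = record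
        { isMonoid = record
          { isSemigroup = record
            { isMagma = record
              { isEquivalence = record
                { refl = pointwise λ _ → refl ; sym = ≈ᵣ-sym ; trans = ≈ᵣ-trans }
              ; ∙-cong = +ᵣ-cong
              }
            ; assoc = λ x y z → pointwise λ n → ℚₚ.+-assoc (seq x n) (seq y n) (seq z n)
            }
          ; identity = (λ x → pointwise λ n → ℚₚ.+-identityˡ (seq x n))
                     , (λ x → pointwise λ n → ℚₚ.+-identityʳ (seq x n))
          }
        ; inverse = (λ x → pointwise λ n → ℚₚ.+-inverseˡ (seq x n))
                  , (λ x → pointwise λ n → ℚₚ.+-inverseʳ (seq x n))
        ; ⁻¹-cong = -ᵣ-cong
        }
      ; comm = λ x y → pointwise λ n → ℚₚ.+-comm (seq x n) (seq y n)
      }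
    ; *-cong = *ᵣ-cong
    ; *-assoc = λ x y z → pointwise λ n → ℚₚ.*-assoc (seq x n) (seq y n) (seq z n)
    ; *-identity = (λ x → pointwise λ n → ℚₚ.*-identityˡ (seq x n))
                 , (λ x → pointwise λ n → ℚₚ.*-identityʳ (seq x n))
    ; distrib = (λ x y z → pointwise λ n → ℚₚ.*-distribˡ-+ (seq x n) (seq y n) (seq z n))
              , (λ x y z → pointwise λ n → ℚₚ.*-distribʳ-+ (seq x n) (seq y n) (seq z n))
    }
  ; *-comm = λ x y → pointwise λ n → ℚₚ.*-comm (seq x n) (seq y n)
  }

ℝ-commutativeRing : CommutativeRing _ _
ℝ-commutativeRing = record { isCommutativeRing = ℝ-isCommutativeRing }

module ℝR = CommutativeRing ℝ-commutativeRing

-- Apartness from 0 in the reals: invertibility and locality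

∣+∣-small : ∀ {ε} p q → ℚ.∣ p ∣ ℚ.< ½ ℚ.* ε → ℚ.∣ q ∣ ℚ.< ½ ℚ.* ε → ℚ.∣ p ℚ.+ q ∣ ℚ.< ε
∣+∣-small {ε} p q ∣p∣<½ε ∣q∣<½ε = ℚₚ.≤-<-trans (ℚₚ.∣p+q∣≤∣p∣+∣q∣ p q)
  (subst (ℚ.∣ p ∣ ℚ.+ ℚ.∣ q ∣ ℚ.<_) (halves ε) (ℚₚ.+-mono-< ∣p∣<½ε ∣q∣<½ε))

-- The order of ℚ is decidable, so the triangle inequality may be read contrapositively. The
-- disjunction in `+ᵣ-#0` comes from here.
∣+∣-large : ∀ {ε} p q → ε ℚ.≤ ℚ.∣ p ℚ.+ q ∣ → ½ ℚ.* ε ℚ.≤ ℚ.∣ p ∣ ⊎ ½ ℚ.* ε ℚ.≤ ℚ.∣ q ∣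
∣+∣-large {ε} p q ε≤∣p+q∣ with ½ ℚ.* ε ℚ.≤? ℚ.∣ p ∣ | ½ ℚ.* ε ℚ.≤? ℚ.∣ q ∣
... | yes p≥ | _      = inj₁ p≥
... | no  _  | yes q≥ = inj₂ q≥
... | no  p≱ | no  q≱ = contradiction
  (ℚₚ.<-≤-trans (∣+∣-small p q (ℚₚ.≰⇒> p≱) (ℚₚ.≰⇒> q≱)) ε≤∣p+q∣) (ℚₚ.<-irrefl refl)

near-large : ∀ {ε} p q → ε ℚ.≤ ℚ.∣ p ∣ → ℚ.∣ p ℚ.- q ∣ ℚ.< ½ ℚ.* ε → ½ ℚ.* ε ℚ.≤ ℚ.∣ q ∣
near-large {ε} p q ε≤∣p∣ near = Sum.[
  (λ far → contradiction (ℚₚ.<-≤-trans near far) (ℚₚ.<-irrefl refl)) , (λ q≥ → q≥) ]′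
  (∣+∣-large (p ℚ.- q) q (subst (λ t → ε ℚ.≤ ℚ.∣ t ∣)
    (solve 2 (λ p q → p := p :- q :+ q) refl p q) ε≤∣p∣))

eventually-large⇒#0 : ∀ x {δ} → 0ℚ ℚ.< δ → (Eventually λ n → δ ℚ.≤ ℚ.∣ seq x n ∣) → x #ᵣ 0ᵣ
eventually-large⇒#0 x {δ} 0<δ large = δ , 0<δ , eventually-map
  (λ n → subst (λ t → δ ℚ.≤ ℚ.∣ t ∣) (sym (ℚₚ.+-identityʳ (seq x n)))) large

#0⇒eventually-large : ∀ x → x #ᵣ 0ᵣ → ∃[ δ ] 0ℚ ℚ.< δ × Eventually λ n → δ ℚ.≤ ℚ.∣ seq x n ∣
#0⇒eventually-large x (δ , 0<δ , large) = δ , 0<δ , eventually-map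
  (λ n → subst (λ t → δ ℚ.≤ ℚ.∣ t ∣) (ℚₚ.+-identityʳ (seq x n))) large

*ᵣ-inverse : ∀ x x#0 → x *ᵣ invᵣ x x#0 ≈ᵣ 1ᵣ
*ᵣ-inverse x x#0 with δ , 0<δ , large ← #0⇒eventually-large x x#0 = eventually-≡⇒≈ᵣ
  (eventually-map (λ n x≥δ → invℚ-inverse (seq x n) (Estimates.pos⇒≢0 (ℚₚ.<-≤-trans 0<δ x≥δ))) large)

-- If `K` bounds `y`, then eventually ½ ≤ ∣x y∣ ≤ K ∣x∣, so `x` stays at distance at least 1/(2K)
-- from 0. This turns algebraic invertibility back into apartness.
inverse⇒#0 : ∀ x y → x *ᵣ y ≈ᵣ 1ᵣ → x #ᵣ 0ᵣ
inverse⇒#0 x y (mk≈ xy≈1) = from-bound (bounded y)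
  where
  from-bound : (∃[ K ] 0ℚ ℚ.< K × Eventually λ n → ℚ.∣ seq y n ∣ ℚ.≤ K) → x #ᵣ 0ᵣ
  from-bound (K , 0<K , y≤K) = from-quotient (Estimates.quotient 0<K (half-pos (ℚₚ.positive⁻¹ 1ℚ)))
    where
    from-quotient : (∃[ δ ] 0ℚ ℚ.< δ × K ℚ.* δ ≡ ½ ℚ.* 1ℚ) → x #ᵣ 0ᵣ
    from-quotient (δ , 0<δ , Kδ≡½) = eventually-large⇒#0 x 0<δ (eventually-map large
      (eventually-× y≤K (xy≈1 (½ ℚ.* 1ℚ) (half-pos (ℚₚ.positive⁻¹ 1ℚ)))))
      where
      large : ∀ n → ℚ.∣ seq y n ∣ ℚ.≤ K × ℚ.∣ seq x n ℚ.* seq y n ℚ.- 1ℚ ∣ ℚ.< ½ ℚ.* 1ℚ →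
              δ ℚ.≤ ℚ.∣ seq x n ∣
      large n (y≤K , near) = ℚₚ.*-cancelˡ-≤-pos K {{positive 0<K}} (begin
        K ℚ.* δ                        ≡⟨ Kδ≡½ ⟩
        ½ ℚ.* 1ℚ                       ≤⟨ near-large 1ℚ (a ℚ.* b) ℚₚ.≤-refl
                                           (subst (ℚ._< ½ ℚ.* 1ℚ) (∣p-q∣≡∣q-p∣ (a ℚ.* b) 1ℚ) near) ⟩
        ℚ.∣ a ℚ.* b ∣                  ≡⟨ ℚₚ.∣p*q∣≡∣p∣*∣q∣ a b ⟩
        ℚ.∣ a ∣ ℚ.* ℚ.∣ b ∣            ≤⟨ ℚₚ.*-monoˡ-≤-nonNeg ℚ.∣ a ∣ {{nonNegative (ℚₚ.0≤∣p∣ a)}} y≤K ⟩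
        ℚ.∣ a ∣ ℚ.* K                  ≡⟨ ℚₚ.*-comm ℚ.∣ a ∣ K ⟩
        K ℚ.* ℚ.∣ a ∣                  ∎)
        where
        open ℚₚ.≤-Reasoning
        a = seq x n
        b = seq y n

-- From an index on where both sequences vary by less than δ / 4, a single rational comparison
-- decides which of the two summands is apart from 0.
+ᵣ-#0 : ∀ x y → x +ᵣ y #ᵣ 0ᵣ → x #ᵣ 0ᵣ ⊎ y #ᵣ 0ᵣ
+ᵣ-#0 x y x+y#0
  with δ , 0<δ , A , large ← #0⇒eventually-large (x +ᵣ y) x+y#0
  with 0<¼δ ← half-pos (half-pos 0<δ)
  with B , x-close ← cauchy x (½ ℚ.* (½ ℚ.* δ)) 0<¼δ
     | C , y-close ← cauchy y (½ ℚ.* (½ ℚ.* δ)) 0<¼δ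
  = Sum.map
    (λ x≥ → eventually-large⇒#0 x 0<¼δ (M , λ n n≥ → near-large (seq x M) (seq x n) x≥
      (x-close M n B≤M (ℕₚ.≤-trans B≤M n≥))))
    (λ y≥ → eventually-large⇒#0 y 0<¼δ (M , λ n n≥ → near-large (seq y M) (seq y n) y≥
      (y-close M n C≤M (ℕₚ.≤-trans C≤M n≥))))
    (∣+∣-large (seq x M) (seq y M) (large M (ℕₚ.m≤m⊔n A (B ℕ.⊔ C))))
  where
  M = A ℕ.⊔ (B ℕ.⊔ C)
  B≤M = ℕₚ.≤-trans (ℕₚ.m≤m⊔n B C) (ℕₚ.m≤n⊔m A (B ℕ.⊔ C))
  C≤M = ℕₚ.≤-trans (ℕₚ.m≤n⊔m B C) (ℕₚ.m≤n⊔m A (B ℕ.⊔ C))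

0≤p*p : ∀ p → 0ℚ ℚ.≤ p ℚ.* p
0≤p*p p with ℚₚ.≤-total 0ℚ p
... | inj₁ 0≤p = subst (ℚ._≤ p ℚ.* p) (ℚₚ.*-zeroʳ p) (ℚₚ.*-monoˡ-≤-nonNeg p {{nonNegative 0≤p}} 0≤p)
... | inj₂ p≤0 = subst (ℚ._≤ p ℚ.* p) (ℚₚ.*-zeroʳ p) (ℚₚ.*-monoˡ-≤-nonPos p {{nonPositive p≤0}} p≤0)

-- Completing the square gives (h + 3/2)² + 27/4, so the bound holds at every index. Reality of `h`
-- matters: over ℂ the expression vanishes at three times a primitive cube root of unity.
h²+3h+9#0 : ∀ h → h *ᵣ h +ᵣ 3ᵣ *ᵣ h +ᵣ fromℚ (+ 9 ℚ./ 1) #ᵣ 0ᵣ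
h²+3h+9#0 h = eventually-large⇒#0 (h *ᵣ h +ᵣ 3ᵣ *ᵣ h +ᵣ fromℚ (+ 9 ℚ./ 1)) (ℚₚ.positive⁻¹ 27/4)
  (0 , λ n _ → bound (seq h n))
  where
  27/4 3/2 : ℚ
  27/4 = + 27 ℚ./ 4
  3/2  = + 3 ℚ./ 2

  complete-square : ∀ q → (q ℚ.+ 3/2) ℚ.* (q ℚ.+ 3/2) ℚ.+ 27/4 ≡
                          q ℚ.* q ℚ.+ (+ 3 ℚ./ 1) ℚ.* q ℚ.+ (+ 9 ℚ./ 1)
  complete-square = solve 1 (λ q → (q :+ con 3/2) :* (q :+ con 3/2) :+ con 27/4 :=
                                   q :* q :+ con (+ 3 ℚ./ 1) :* q :+ con (+ 9 ℚ./ 1)) refl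

  bound : ∀ q → 27/4 ℚ.≤ ℚ.∣ q ℚ.* q ℚ.+ (+ 3 ℚ./ 1) ℚ.* q ℚ.+ (+ 9 ℚ./ 1) ∣
  bound q = subst (λ t → 27/4 ℚ.≤ ℚ.∣ t ∣) (complete-square q) (subst (27/4 ℚ.≤_)
    (sym (ℚₚ.0≤p⇒∣p∣≡p (ℚₚ.≤-trans (ℚₚ.<⇒≤ (ℚₚ.positive⁻¹ 27/4)) 27/4≤))) 27/4≤)
    where
    27/4≤ : 27/4 ℚ.≤ (q ℚ.+ 3/2) ℚ.* (q ℚ.+ 3/2) ℚ.+ 27/4
    27/4≤ = subst (ℚ._≤ (q ℚ.+ 3/2) ℚ.* (q ℚ.+ 3/2) ℚ.+ 27/4) (ℚₚ.+-identityˡ 27/4)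
      (ℚₚ.+-monoˡ-≤ 27/4 (0≤p*p (q ℚ.+ 3/2)))

-- The complex numbers as a local ring

≈-pointwise : ∀ {z w} → (∀ n → seq (re z) n ≡ seq (re w) n) → (∀ n → seq (im z) n ≡ seq (im w) n) →
              z ≈ w
≈-pointwise re≡ im≡ = pointwise re≡ , pointwise im≡

*-cong : ∀ {z w z′ w′} → z ≈ w → z′ ≈ w′ → z * z′ ≈ w * w′
*-cong (re≈ , im≈) (re′≈ , im′≈) =
    +ᵣ-cong (*ᵣ-cong re≈ re′≈) (-ᵣ-cong (*ᵣ-cong im≈ im′≈))
  , +ᵣ-cong (*ᵣ-cong re≈ im′≈) (*ᵣ-cong im≈ re′≈)

*-assoc : ∀ x y z → (x * y) * z ≈ x * (y * z)
*-assoc (a +i b) (c +i d) (e +i f) = ≈-pointwise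
  (λ n → solve 6 (λ a b c d e f →
    (a :* c :- b :* d) :* e :- (a :* d :+ b :* c) :* f :=
    a :* (c :* e :- d :* f) :- b :* (c :* f :+ d :* e)) refl
    (seq a n) (seq b n) (seq c n) (seq d n) (seq e n) (seq f n))
  (λ n → solve 6 (λ a b c d e f →
    (a :* c :- b :* d) :* f :+ (a :* d :+ b :* c) :* e :=
    a :* (c :* f :+ d :* e) :+ b :* (c :* e :- d :* f)) refl
    (seq a n) (seq b n) (seq c n) (seq d n) (seq e n) (seq f n))

*-comm : ∀ z w → z * w ≈ w * z
*-comm (a +i b) (c +i d) = ≈-pointwise
  (λ n → solve 4 (λ a b c d → a :* c :- b :* d := c :* a :- d :* b) refl
    (seq a n) (seq b n) (seq c n) (seq d n))
  (λ n → solve 4 (λ a b c d → a :* d :+ b :* c := c :* b :+ d :* a) refl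
    (seq a n) (seq b n) (seq c n) (seq d n))

*-identityˡ : ∀ z → 1ℂ * z ≈ z
*-identityˡ (a +i b) = ≈-pointwise
  (λ n → solve 2 (λ a b → con 1ℚ :* a :- con 0ℚ :* b := a) refl (seq a n) (seq b n))
  (λ n → solve 2 (λ a b → con 1ℚ :* b :+ con 0ℚ :* a := b) refl (seq a n) (seq b n))

*-distribˡ-+ : ∀ x y z → x * (y + z) ≈ x * y + x * z
*-distribˡ-+ (a +i b) (c +i d) (e +i f) = ≈-pointwise
  (λ n → solve 6 (λ a b c d e f →
    a :* (c :+ e) :- b :* (d :+ f) := (a :* c :- b :* d) :+ (a :* e :- b :* f)) refl
    (seq a n) (seq b n) (seq c n) (seq d n) (seq e n) (seq f n))
  (λ n → solve 6 (λ a b c d e f →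
    a :* (d :+ f) :+ b :* (c :+ e) := (a :* d :+ b :* c) :+ (a :* f :+ b :* e)) refl
    (seq a n) (seq b n) (seq c n) (seq d n) (seq e n) (seq f n))

≈-trans : ∀ {x y z} → x ≈ y → y ≈ z → x ≈ z
≈-trans (p , q) (p′ , q′) = ≈ᵣ-trans p p′ , ≈ᵣ-trans q q′

+-cong : ∀ {z w z′ w′} → z ≈ w → z′ ≈ w′ → z + z′ ≈ w + w′
+-cong (p , q) (p′ , q′) = +ᵣ-cong p p′ , +ᵣ-cong q q′

ℂ-isCommutativeRing : IsCommutativeRing _≈_ _+_ _*_ -_ 0ℂ 1ℂ
ℂ-isCommutativeRing = record
  { isRing = record
    { +-isAbelianGroup = record
      { isGroup = record
        { isMonoid = record
          { isSemigroup = record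
            { isMagma = record
              { isEquivalence = record
                { refl = ℝR.refl , ℝR.refl
                ; sym = λ (p , q) → ≈ᵣ-sym p , ≈ᵣ-sym q
                ; trans = ≈-trans
                }
              ; ∙-cong = +-cong
              }
            ; assoc = λ x y z → ℝR.+-assoc (re x) (re y) (re z) , ℝR.+-assoc (im x) (im y) (im z)
            }
          ; identity = (λ z → ℝR.+-identityˡ (re z) , ℝR.+-identityˡ (im z))
                     , (λ z → ℝR.+-identityʳ (re z) , ℝR.+-identityʳ (im z))
          }
        ; inverse = (λ z → ℝR.-‿inverseˡ (re z) , ℝR.-‿inverseˡ (im z))
                  , (λ z → ℝR.-‿inverseʳ (re z) , ℝR.-‿inverseʳ (im z))
        ; ⁻¹-cong = λ (p , q) → -ᵣ-cong p , -ᵣ-cong q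
        }
      ; comm = λ z w → ℝR.+-comm (re z) (re w) , ℝR.+-comm (im z) (im w)
      }
    ; *-cong = *-cong
    ; *-assoc = *-assoc
    ; *-identity = *-identityˡ , λ z → ≈-trans (*-comm z 1ℂ) (*-identityˡ z)
    ; distrib = *-distribˡ-+ , λ x y z → ≈-trans (*-comm (y + z) x)
        (≈-trans (*-distribˡ-+ x y z) (+-cong (*-comm x y) (*-comm x z)))
    }
  ; *-comm = *-comm
  }

ℂ-commutativeRing : CommutativeRing _ _
ℂ-commutativeRing = record { isCommutativeRing = ℂ-isCommutativeRing }

ι-+ : ∀ x y → ι (x +ᵣ y) ≈ ι x + ι y
ι-+ x y = ≈-pointwise (λ _ → refl) (λ _ → refl)

ι-neg : ∀ x → ι (-ᵣ x) ≈ - ι x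
ι-neg x = ≈-pointwise (λ _ → refl) (λ _ → refl)

ι-* : ∀ x y → ι (x *ᵣ y) ≈ ι x * ι y
ι-* x y = ≈-pointwise
  (λ n → solve 2 (λ x y → x :* y := x :* y :- con 0ℚ :* con 0ℚ) refl (seq x n) (seq y n))
  (λ n → solve 2 (λ x y → con 0ℚ := x :* con 0ℚ :+ con 0ℚ :* y) refl (seq x n) (seq y n))

-- Rationals go to constant sequences, so that `3#` is `ι 3ᵣ` by definition; `eval-ρ` and
-- `disc-unit` rely on this.
ℂ-scalar : CommutativeRing.rawRing ℚₚ.+-*-commutativeRing
           -Raw-AlmostCommutative⟶ fromCommutativeRing ℂ-commutativeRing
ℂ-scalar = record
  { ⟦_⟧    = λ q → ι (fromℚ q)
  ; +-homo = λ p q → ≈-pointwise (λ _ → refl) (λ _ → refl)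
  ; *-homo = λ p q → ≈-trans (≈-pointwise (λ _ → refl) (λ _ → refl)) (ι-* (fromℚ p) (fromℚ q))
  ; -‿homo = λ p → ≈-pointwise (λ _ → refl) (λ _ → refl)
  ; 0-homo = ≈-pointwise (λ _ → refl) (λ _ → refl)
  ; 1-homo = ≈-pointwise (λ _ → refl) (λ _ → refl)
  }

module ℂR = CommutativeRing ℂ-commutativeRing
open LocalAlgebra ℂ-commutativeRing ℂ-scalar

*-inverse : ∀ z z#0 → z * inv z z#0 ≈ 1ℂ
*-inverse z@(a +i b) z#0 =
    ℝR.trans (pointwise λ n → solve 3 (λ a b m →
        a :* (a :* m) :- b :* (:- b :* m) := (a :* a :+ b :* b) :* m) refl
        (seq a n) (seq b n) (seq m n))
      (*ᵣ-inverse ∣ z ∣² ∣z∣²#0)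
  , pointwise λ n → solve 3 (λ a b m → a :* (:- b :* m) :+ b :* (a :* m) := con 0ℚ) refl
      (seq a n) (seq b n) (seq m n)
  where
  ∣z∣²#0 = #0⇒∣∣²#0 z z#0
  m = invᵣ ∣ z ∣² ∣z∣²#0

#0⇒unit : ∀ z → z # 0ℂ → Unit z
#0⇒unit z z#0 = inv z z#0 , *-inverse z z#0

∣∣²-* : ∀ z w → ∣ z ∣² *ᵣ ∣ w ∣² ≈ᵣ ∣ z * w ∣²
∣∣²-* (a +i b) (c +i d) = pointwise λ n → solve 4 (λ a b c d →
    (a :* a :+ b :* b) :* (c :* c :+ d :* d) :=
    (a :* c :- b :* d) :* (a :* c :- b :* d) :+ (a :* d :+ b :* c) :* (a :* d :+ b :* c)) refl
  (seq a n) (seq b n) (seq c n) (seq d n)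

∣∣²-cong : ∀ {z w} → z ≈ w → ∣ z ∣² ≈ᵣ ∣ w ∣²
∣∣²-cong (p , q) = +ᵣ-cong (*ᵣ-cong p p) (*ᵣ-cong q q)

square-#0 : ∀ x → x *ᵣ x #ᵣ 0ᵣ → x #ᵣ 0ᵣ
square-#0 x x²#0 = inverse⇒#0 x (x *ᵣ invᵣ (x *ᵣ x) x²#0)
  (ℝR.trans (ℝR.sym (ℝR.*-assoc x x _)) (*ᵣ-inverse (x *ᵣ x) x²#0))

-- The squared modulus is multiplicative, so an inverse of `z` yields an inverse of `∣ z ∣²` in ℝ.
-- Locality of ℝ then finds a summand, the square of the real or of the imaginary part, that is
-- apart from 0.
unit⇒#0 : ∀ z → Unit z → z # 0ℂ
unit⇒#0 z (w , zw≈1) = Sum.map (square-#0 (re z)) (square-#0 (im z))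
  (+ᵣ-#0 (re z *ᵣ re z) (im z *ᵣ im z) (inverse⇒#0 ∣ z ∣² ∣ w ∣² ∣z∣²∣w∣²≈1))
  where
  ∣z∣²∣w∣²≈1 : ∣ z ∣² *ᵣ ∣ w ∣² ≈ᵣ 1ᵣ
  ∣z∣²∣w∣²≈1 = ℝR.trans (∣∣²-* z w) (ℝR.trans (∣∣²-cong zw≈1) (pointwise λ _ → refl))

#0-+ : ∀ z w → z + w # 0ℂ → z # 0ℂ ⊎ w # 0ℂ
#0-+ z w (inj₁ re#0) = Sum.map inj₁ inj₁ (+ᵣ-#0 (re z) (re w) re#0)
#0-+ z w (inj₂ im#0) = Sum.map inj₂ inj₂ (+ᵣ-#0 (im z) (im w) im#0)

unit-+ : ∀ {z w} → Unit (z + w) → Unit z ⊎ Unit w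
unit-+ {z} {w} z+w-unit = Sum.map (#0⇒unit z) (#0⇒unit w) (#0-+ z w (unit⇒#0 (z + w) z+w-unit))

/-cancelʳ : ∀ z w w#0 → z / w [ w#0 ] * w ≈ z
/-cancelʳ z w w#0 = begin
  z * inv w w#0 * w     ≈⟨ *-assoc z (inv w w#0) w ⟩
  z * (inv w w#0 * w)   ≈⟨ ℂR.*-congˡ (≈-trans (*-comm (inv w w#0) w) (*-inverse w w#0)) ⟩
  z * 1ℂ                ≈⟨ ℂR.*-identityʳ z ⟩
  z                     ∎
  where open import Relation.Binary.Reasoning.Setoid ℂR.setoid

ι-#0⇒unit : ∀ x → x #ᵣ 0ᵣ → Unit (ι x)
ι-#0⇒unit x x#0 = #0⇒unit (ι x) (inj₁ x#0)

-- The zeros of ρ as an orbit of η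

ι-^ : ∀ x n → ι (x ^ᵣ n) ≈ ι x ^ n
ι-^ x zero = ℂR.refl
ι-^ x (suc n) = ≈-trans (ι-* x (x ^ᵣ n)) (ℂR.*-congˡ (ι-^ x n))

eval-ρ : ∀ h s x → eval (ρ h s) x ≈ F (ι h) (ι s) x
eval-ρ h s x = poly-cong
  {ι (h *ᵣ s)} {ι h * ι s} {ι (-ᵣ ((h +ᵣ 3ᵣ) *ᵣ s ^ᵣ 2))} { - ((ι h + ι 3ᵣ) * ι s ^ 2)}
  {ι (s ^ᵣ 3)} {ι s ^ 3} {x} {x}
  (ι-* h s) middle (ι-^ s 3) ℂR.refl
  where
  open import Relation.Binary.Reasoning.Setoid ℂR.setoid
  middle : ι (-ᵣ ((h +ᵣ 3ᵣ) *ᵣ s ^ᵣ 2)) ≈ - ((ι h + ι 3ᵣ) * ι s ^ 2)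
  middle = begin
    ι (-ᵣ ((h +ᵣ 3ᵣ) *ᵣ s ^ᵣ 2))    ≈⟨ ι-neg ((h +ᵣ 3ᵣ) *ᵣ s ^ᵣ 2) ⟩
    - ι ((h +ᵣ 3ᵣ) *ᵣ s ^ᵣ 2)       ≈⟨ ℂR.-‿cong (ι-* (h +ᵣ 3ᵣ) (s ^ᵣ 2)) ⟩
    - (ι (h +ᵣ 3ᵣ) * ι (s ^ᵣ 2))    ≈⟨ ℂR.-‿cong (*-cong (ι-+ h 3ᵣ) (ι-^ s 2)) ⟩
    - ((ι h + ι 3ᵣ) * ι s ^ 2)      ∎

module Orbit (h s : ℝ) (s#0 : s #ᵣ 0ᵣ) (α : ℂ) (α-zero : α ∈ ζ h s) where

  open import Relation.Binary.Reasoning.Setoid ℂR.setoid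

  disc-unit : Unit (ι h * ι h + 3# * ι h + 9#)
  disc-unit = unit-resp {ι (h *ᵣ h +ᵣ 3ᵣ *ᵣ h +ᵣ 9ᵣ)} (begin
    ι (h *ᵣ h +ᵣ 3ᵣ *ᵣ h +ᵣ 9ᵣ)        ≈⟨ ι-+ (h *ᵣ h +ᵣ 3ᵣ *ᵣ h) 9ᵣ ⟩
    ι (h *ᵣ h +ᵣ 3ᵣ *ᵣ h) + 9#         ≈⟨ ℂR.+-congʳ {9#} (ι-+ (h *ᵣ h) (3ᵣ *ᵣ h)) ⟩
    ι (h *ᵣ h) + ι (3ᵣ *ᵣ h) + 9#      ≈⟨ ℂR.+-congʳ {9#} (+-cong (ι-* h h) (ι-* 3ᵣ h)) ⟩
    ι h * ι h + 3# * ι h + 9#          ∎)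
    (ι-#0⇒unit (h *ᵣ h +ᵣ 3ᵣ *ᵣ h +ᵣ 9ᵣ) (h²+3h+9#0 h))
    where 9ᵣ = fromℚ (+ 9 ℚ./ 1)

  Fα≈0 : F (ι h) (ι s) α ≈ 0ℂ
  Fα≈0 = begin
    F (ι h) (ι s) α   ≈⟨ eval-ρ h s α ⟨
    eval (ρ h s) α    ≈⟨ α-zero ⟩
    0ℂ                ∎

  open Zeros {ι h} {ι s} {α} (ι-#0⇒unit s s#0) disc-unit Fα≈0

  s-α#0 : (ι s - α) # 0ℂ
  s-α#0 = unit⇒#0 (ι s - α) s-a-unit

  α#0 : α # 0ℂ
  α#0 = unit⇒#0 α a-unit

  -- Characterising `b` and `c` by equations without division lets the explicit quotients and the
  -- iterates of `η` be handled by one statement.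
  zeros≐ : ∀ b c → b * (ι s - α) ≈ ι s ^ 2 → c * α ≈ - (ι s * (ι s - α)) → ζ h s ≐ ⟅ α , b , c ⟆
  zeros≐ b c b-eq c-eq =
      (λ {x} x-zero → zero⇒root {b} {c} b-eq c-eq (λ {z} {w} → unit-+ {z} {w}) {x}
        (≈-trans (ℂR.sym {eval (ρ h s) x} {F (ι h) (ι s) x} (eval-ρ h s x)) x-zero))
    , (λ {x} x-root → ≈-trans (eval-ρ h s x) (root⇒zero {b} {c} b-eq c-eq {x} x-root))

  -- Division takes the proof of apartness as an argument, so the quotients are treated for an
  -- arbitrary such proof.
  module _ (s-α#0 : (ι s - α) # 0ℂ) where

    private
      ηα : ℂ
      ηα = η s α s-α#0

    ηα-eq : ηα * (ι s - α) ≈ ι s ^ 2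
    ηα-eq = /-cancelʳ (ι s ^ 2) (ι s - α) s-α#0

    s-ηα#0 : (ι s - η s α s-α#0) # 0ℂ
    s-ηα#0 = unit⇒#0 (ι s - ηα) (s-b-unit {ηα} ηα-eq)

    explicit : (α#0 : α # 0ℂ) →
      ζ h s ≐ ⟅ α , ι s ^ 2 / (ι s - α) [ s-α#0 ] , - ((ι s * (ι s - α)) / α [ α#0 ]) ⟆
    explicit α#0 = zeros≐ (ι s ^ 2 / (ι s - α) [ s-α#0 ]) (- w) ηα-eq (begin
      - w * α                ≈⟨ RingProperties.-‿distribˡ-* ℂR.ring w α ⟨
      - (w * α)              ≈⟨ ℂR.-‿cong (/-cancelʳ (ι s * (ι s - α)) α α#0) ⟩
      - (ι s * (ι s - α))    ∎)
      where w = (ι s * (ι s - α)) / α [ α#0 ]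

    iterated : (s-ηα#0 : (ι s - η s α s-α#0) # 0ℂ) →
      ζ h s ≐ ⟅ α , η s α s-α#0 , η s (η s α s-α#0) s-ηα#0 ⟆
    iterated s-ηα#0 = zeros≐ (η s α s-α#0) (η s (η s α s-α#0) s-ηα#0) ηα-eq
      (second-iterate {η s α s-α#0} {η s (η s α s-α#0) s-ηα#0} ηα-eq
        (/-cancelʳ (ι s ^ 2) (ι s - η s α s-α#0) s-ηα#0))

-- Normal form of a Ramanujan cubic

module NormalForm (P : RamanujanCubic) where

  open RamanujanCubic P renaming (∛r to t)
  open import Relation.Binary.Reasoning.Setoid ℝR.setoid

  t#0 : t #ᵣ 0ᵣ
  -- Because t³ = r, the inverse of `t` is t²/r.
  t#0 = inverse⇒#0 t (t ^ᵣ 2 *ᵣ invᵣ r r≠0) (begin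
    t *ᵣ (t ^ᵣ 2 *ᵣ invᵣ r r≠0)   ≈⟨ ℝR.*-assoc t (t ^ᵣ 2) (invᵣ r r≠0) ⟨
    t ^ᵣ 3 *ᵣ invᵣ r r≠0          ≈⟨ ℝR.*-congʳ ∛r-cubed ⟩
    r *ᵣ invᵣ r r≠0               ≈⟨ *ᵣ-inverse r r≠0 ⟩
    1ᵣ                            ∎)

  t⁻¹ h : ℝ
  t⁻¹ = invᵣ t t#0
  h   = p *ᵣ t⁻¹

  ht≈p : h *ᵣ t ≈ᵣ p
  ht≈p = begin
    p *ᵣ t⁻¹ *ᵣ t     ≈⟨ ℝR.*-assoc p t⁻¹ t ⟩
    p *ᵣ (t⁻¹ *ᵣ t)   ≈⟨ ℝR.*-congˡ (ℝR.*-comm t⁻¹ t) ⟩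
    p *ᵣ (t *ᵣ t⁻¹)   ≈⟨ ℝR.*-congˡ (*ᵣ-inverse t t#0) ⟩
    p *ᵣ 1ᵣ           ≈⟨ ℝR.*-identityʳ p ⟩
    p                 ∎

  -- With h t = p the defining condition p t + 3 t² + q = 0 reads (h + 3) t² + q = 0; `expand`
  -- isolates the product h t so that `p` can replace it.
  q≈ : q ≈ᵣ -ᵣ ((h +ᵣ 3ᵣ) *ᵣ t ^ᵣ 2)
  q≈ = GroupProperties.inverseʳ-unique ℝR.+-group ((h +ᵣ 3ᵣ) *ᵣ t ^ᵣ 2) q (begin
    (h +ᵣ 3ᵣ) *ᵣ t ^ᵣ 2 +ᵣ q           ≈⟨ pointwise (λ n → expand (seq h n) (seq t n) (seq q n)) ⟩
    h *ᵣ t *ᵣ t +ᵣ 3ᵣ *ᵣ t ^ᵣ 2 +ᵣ q   ≈⟨ ℝR.+-congʳ (ℝR.+-congʳ (ℝR.*-congʳ ht≈p)) ⟩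
    p *ᵣ t +ᵣ 3ᵣ *ᵣ t ^ᵣ 2 +ᵣ q        ≈⟨ condition ⟩
    0ᵣ                                 ∎)
    where
    3ℚ = + 3 ℚ./ 1
    expand : ∀ h t q → (h ℚ.+ 3ℚ) ℚ.* (t ℚ.* (t ℚ.* 1ℚ)) ℚ.+ q ≡
                       h ℚ.* t ℚ.* t ℚ.+ 3ℚ ℚ.* (t ℚ.* (t ℚ.* 1ℚ)) ℚ.+ q
    expand = solve 3 (λ h t q →
      (h :+ con 3ℚ) :* (t :* (t :* con 1ℚ)) :+ q :=
      h :* t :* t :+ con 3ℚ :* (t :* (t :* con 1ℚ)) :+ q) refl

  polynomial≋ρ : polynomial ≋ ρ h t
  polynomial≋ρ = ≈ᵣ-sym ht≈p , q≈ , ≈ᵣ-sym ∛r-cubed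

-- Scaling the zeros to the case s = -1

module Homothety (h s : ℝ) (s#0 : s #ᵣ 0ᵣ) where

  open import Relation.Binary.Reasoning.Setoid ℂR.setoid

  -s#0 : - ι s # 0ℂ
  -s#0 = unit⇒#0 (- ι s) (unit-neg {ι s} (ι-#0⇒unit s s#0))

  -- Both inclusions of `ζ≐` follow from this: reading from left to right, the unit -s³ is
  -- cancelled, and from right to left a multiple of 0 is 0.
  eval-scaled : ∀ x z → x ≈ - ι s * z →
                eval (ρ h s) x ≈ - (ι s ^ 3) * eval (ρ h (-ᵣ 1ᵣ)) z
  eval-scaled x z x≈-sz = begin
    eval (ρ h s) x                        ≈⟨ eval-ρ h s x ⟩
    F (ι h) (ι s) x                       ≈⟨ F-cong (ι h) {ι s} {ι s} {x} { - ι s * z} ℂR.refl x≈-sz ⟩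
    F (ι h) (ι s) (- ι s * z)             ≈⟨ F-homothety (ι h) (ι s) z ⟩
    - (ι s ^ 3) * F (ι h) (- 1ℂ) z        ≈⟨ *-congˡ′ (F-cong (ι h) {ι (-ᵣ 1ᵣ)} { - 1ℂ} {z} {z} (ι-neg 1ᵣ) ℂR.refl) ⟨
    - (ι s ^ 3) * F (ι h) (ι (-ᵣ 1ᵣ)) z   ≈⟨ *-congˡ′ (eval-ρ h (-ᵣ 1ᵣ) z) ⟨
    - (ι s ^ 3) * eval (ρ h (-ᵣ 1ᵣ)) z    ∎
    where
    *-congˡ′ : ∀ {u v} → u ≈ v → - (ι s ^ 3) * u ≈ - (ι s ^ 3) * v
    *-congˡ′ {u} {v} = ℂR.*-congˡ { - (ι s ^ 3)} {u} {v}

  ζ≐ : ζ h s ≐ (- ι s) · ζ h (-ᵣ 1ᵣ)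
  ζ≐ = (λ {x} → to x) , (λ {x} → from x)
    where
    to : ∀ x → x ∈ ζ h s → x ∈ (- ι s) · ζ h (-ᵣ 1ᵣ)
    to x x-zero = z , unit*x≈0⇒x≈0 { - (ι s ^ 3)} {eval (ρ h (-ᵣ 1ᵣ)) z}
      (unit-neg {ι s ^ 3} (unit-^ {ι s} (ι-#0⇒unit s s#0) 3))
      (begin
        - (ι s ^ 3) * eval (ρ h (-ᵣ 1ᵣ)) z   ≈⟨ eval-scaled x z x≈-sz ⟨
        eval (ρ h s) x                       ≈⟨ x-zero ⟩
        0ℂ                                   ∎)
      , x≈-sz
      where
      z = x / (- ι s) [ -s#0 ]
      x≈-sz : x ≈ - ι s * z
      x≈-sz = begin
        x             ≈⟨ /-cancelʳ x (- ι s) -s#0 ⟨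
        z * - ι s     ≈⟨ *-comm z (- ι s) ⟩
        - ι s * z     ∎

    from : ∀ x → x ∈ (- ι s) · ζ h (-ᵣ 1ᵣ) → x ∈ ζ h s
    from x (z , z-zero , x≈-sz) = begin
      eval (ρ h s) x                       ≈⟨ eval-scaled x z x≈-sz ⟩
      - (ι s ^ 3) * eval (ρ h (-ᵣ 1ᵣ)) z   ≈⟨ x≈0⇒k*x≈0 (- (ι s ^ 3)) {eval (ρ h (-ᵣ 1ᵣ)) z} z-zero ⟩
      0ℂ                                   ∎

theorem8 : ( (h s : ℝ) → s #ᵣ 0ᵣ → (α : ℂ) → α ∈ ζ h s →
    Σ[ s-α≠0 ∈ (ι s - α) # 0ℂ ]
    Σ[ α≠0 ∈ α # 0ℂ ]
    Σ[ s-ηα≠0 ∈ (ι s - η s α s-α≠0) # 0ℂ ]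
    ( ζ h s ≐ ⟅ α , ι s ^ 2 / (ι s - α) [ s-α≠0 ] , - ((ι s * (ι s - α)) / α [ α≠0 ]) ⟆
    × ζ h s ≐ ⟅ α , η s α s-α≠0 , η s (η s α s-α≠0) s-ηα≠0 ⟆ ) )
    ×
    ( (P : RamanujanCubic) → let open RamanujanCubic P in
    Σ[ ∛r≠0 ∈ ∛r #ᵣ 0ᵣ ]
    ( polynomial ≋ ρ (p /ᵣ ∛r [ ∛r≠0 ]) ∛r
    × ζ (p /ᵣ ∛r [ ∛r≠0 ]) ∛r ≐ (- ι ∛r) · ζ (p /ᵣ ∛r [ ∛r≠0 ]) (-ᵣ 1ᵣ) ) )
theorem8 =
    (λ h s s#0 α α-zero → let open Orbit h s s#0 α α-zero in
      s-α#0 , α#0 , s-ηα#0 s-α#0 , explicit s-α#0 α#0 , iterated s-α#0 (s-ηα#0 s-α#0))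
  , (λ P → let open NormalForm P in
      t#0 , polynomial≋ρ , Homothety.ζ≐ h (RamanujanCubic.∛r P) t#0)
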